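{- Let $Sp(K,S)$ be a split graph such that $|K|\ge 2$. If $\operatorname{Cker}(Sp)\ne\{0\}$, then $\operatorname{Supp}(Sp)\cap K\ne\varnothing$ if and only if $\dim(\operatorname{Cker}(Sp))=1$.
   Context: Graphs are finite and simple. A split graph is a graph $Sp$ whose vertex set is a disjoint union of a clique $K$ and an independent set $S$; the pair $(K,S)$ is called an s-partition, and $Sp(K,S)$ denotes $Sp$ together with this s-partition. Both $K$ and $S$ are assumed nonempty. With the vertices ordered as $(K,S)$, the adjacency matrix is \[A(Sp)=\begin{pmatrix} J-I & R\\ R^t & 0\end{pmatrix},\] where $J$ is an all-ones matrix, $I$ the identity, and $R$ is the $|K|\times|S|$ $0/1$ biadjacency matrix ($R_{uv}=1$ iff $u\in K$ and $v\in S$ are adjacent). $\mathcal{N}(A)$ and $\operatorname{im}(A)$ are the nullspace and column space of a real matrix $A$. $\operatorname{Supp}(Sp)$ is the set of vertices $v$ such that $x_v\ne 0$ for some $x\in\mathcal{N}(A(Sp))$. For $|K|\ge 2$ the matrix $I-J$ of order $|K|$ is invertible, and the clique-kernel is $\operatorname{Cker}(Sp)=\mathcal{N}(R^t)\cap\operatorname{im}((I-J)^{ -1}R)\subseteq\mathbb{R}^{|K|}$. -}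

module Defs where

open import Level using (Level; 0ℓ; _⊔_) renaming (suc to lsuc)
open import Algebra.Apartness.Bundles using (HeytingField; HeytingCommutativeRing)
open import Algebra.Bundles using (CommutativeRing)
import Algebra.Apartness.Properties.HeytingCommutativeRing as HCRProperties
import Algebra.Properties.Ring as RingProperties
import Algebra.Properties.Semiring.Mult as SemiringMult
import Algebra.Properties.Semiring.Sum as SemiringSum
open import Data.Bool.Base using (if_then_else_)
open import Data.Fin.Base using (Fin; zero; suc; splitAt; join)
import Data.Fin.Properties as Fin
open import Data.Nat.Base as ℕ using (ℕ; NonZero; s≤s; z≤n)
open import Data.Product.Base using (∃-syntax; _×_; _,_; proj₁; proj₂)
open import Data.Sum.Base using (_⊎_; inj₁; inj₂)
open import Data.Vec.Functional using (Vector)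
import Data.Vec.Functional.Relation.Binary.Equality.Setoid as VectorEquality
open import Function.Base using (_∘_)
open import Function.Bundles using (_↔_; Inverse)
open import Relation.Binary.Core using (Rel)
open import Relation.Binary.Definitions using (Decidable; Symmetric)
open import Relation.Binary.PropositionalEquality as ≡ using (_≡_; _≢_)
import Relation.Binary.Reasoning.Setoid as SetoidReasoning
open import Relation.Binary.Structures using (IsStrictPartialOrder)
open import Relation.Nullary using (¬_; Dec; does; yes; no; contradiction)
open import Relation.Unary using (Pred; _∈_; _∩_)

-- The library has no real numbers, so ℝ is given by its axioms: an
-- Archimedean, Cauchy-complete ordered field.  Inequality x ≠ y is the
-- apartness x # y, which is tight (¬ x # y iff x ≈ y); classically it is
-- just ¬ x ≈ y.  Nontriviality 1# # 0# already holds in every HeytingField.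
record Reals c ℓ₁ ℓ₂ ℓ₃ : Set (lsuc (c ⊔ ℓ₁ ⊔ ℓ₂ ⊔ ℓ₃)) where
  infix 4 _<_
  field
    heytingField : HeytingField c ℓ₁ ℓ₂

  open HeytingField heytingField public

  commutativeRing : CommutativeRing c ℓ₁
  commutativeRing = HeytingCommutativeRing.commutativeRing heytingCommutativeRing

  open CommutativeRing commutativeRing public using (ring; semiring)
  open SemiringMult semiring public using () renaming (_×_ to _·_)

  field
    _<_                  : Rel Carrier ℓ₃
    isStrictPartialOrder : IsStrictPartialOrder _≈_ _<_
    <⇒#                  : ∀ {x y} → x < y → x # y
    #⇒<⊎>                : ∀ {x y} → x # y → x < y ⊎ y < x
    +-monoˡ-<            : ∀ {x y} z → x < y → x + z < y + z
    *-positive           : ∀ {x y} → 0# < x → 0# < y → 0# < x * y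
    archimedean          : ∀ x → ∃[ n ] x < n · 1#

  Cauchy : (ℕ → Carrier) → Set (c ⊔ ℓ₃)
  Cauchy f = ∀ ε → 0# < ε →
             ∃[ N ] ∀ m n → N ℕ.≤ m → N ℕ.≤ n → f m - f n < ε

  _ConvergesTo_ : (ℕ → Carrier) → Carrier → Set (c ⊔ ℓ₃)
  f ConvergesTo l = ∀ ε → 0# < ε →
                    ∃[ N ] ∀ n → N ℕ.≤ n → (f n - l < ε) × (l - f n < ε)

  field
    complete : ∀ f → Cauchy f → ∃[ l ] f ConvergesTo l

module LinearAlgebra {c ℓ₁ ℓ₂ ℓ₃} (ℝ : Reals c ℓ₁ ℓ₂ ℓ₃) where
  open Reals ℝ hiding (zero)
  open SemiringSum semiring
  open VectorEquality setoid using (_≋_)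

  Matrix : ℕ → ℕ → Set c
  Matrix m n = Fin m → Fin n → Carrier

  infix 4 _≋ₘ_
  _≋ₘ_ : ∀ {m n} → Rel (Matrix m n) ℓ₁
  A ≋ₘ B = ∀ i j → A i j ≈ B i j

  𝟎 : ∀ {n} → Vector Carrier n
  𝟎 _ = 0#

  indicator : ∀ {p} {P : Set p} → Dec P → Carrier
  indicator P? = if does P? then 1# else 0#

  I J : ∀ n → Matrix n n
  I n i j = indicator (i Fin.≟ j)
  J n i j = 1#

  infixl 6 _⊖_
  _⊖_ : ∀ {m n} → Matrix m n → Matrix m n → Matrix m n
  (A ⊖ B) i j = A i j - B i j

  infixl 7 _⊗_
  _⊗_ : ∀ {l m n} → Matrix l m → Matrix m n → Matrix l n
  (A ⊗ B) i j = ∑[ k < _ ] (A i k * B k j)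

  infixr 7 _⊛_
  _⊛_ : ∀ {m n} → Matrix m n → Vector Carrier n → Vector Carrier m
  (A ⊛ x) i = ∑[ j < _ ] (A i j * x j)

  infix 8 _ᵀ
  _ᵀ : ∀ {m n} → Matrix m n → Matrix n m
  (A ᵀ) i j = A j i

  𝒩 : ∀ {m n} → Matrix m n → Pred (Vector Carrier n) ℓ₁
  𝒩 A x = A ⊛ x ≋ 𝟎

  im : ∀ {m n} → Matrix m n → Pred (Vector Carrier m) (c ⊔ ℓ₁)
  im A y = ∃[ x ] A ⊛ x ≋ y

  Invertible : ∀ {n} → Matrix n n → Set (c ⊔ ℓ₁)
  Invertible {n} A = ∃[ B ] (A ⊗ B ≋ₘ I n) × (B ⊗ A ≋ₘ I n)

  inverse : ∀ {n} {A : Matrix n n} → Invertible A → Matrix n n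
  inverse = proj₁

  -- W ≠ {0} for a linear subspace W.
  Nonzero : ∀ {n p} → Pred (Vector Carrier n) p → Set (c ⊔ ℓ₂ ⊔ p)
  Nonzero W = ∃[ x ] x ∈ W × (∃[ i ] x i # 0#)

  combination : ∀ {d n} → Vector Carrier d → (Fin d → Vector Carrier n) →
                Vector Carrier n
  combination a b i = ∑[ j < _ ] (a j * b j i)

  LinearlyIndependent : ∀ {d n} → (Fin d → Vector Carrier n) → Set (c ⊔ ℓ₁)
  LinearlyIndependent b = ∀ a → combination a b ≋ 𝟎 → a ≋ 𝟎

  record IsBasis {d n p} (W : Pred (Vector Carrier n) p)
                 (b : Fin d → Vector Carrier n) : Set (c ⊔ ℓ₁ ⊔ p) where
    field
      member      : ∀ j → b j ∈ W
      independent : LinearlyIndependent b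
      spanning    : ∀ {x} → x ∈ W → ∃[ a ] combination a b ≋ x

  -- dim W = d, for a linear subspace W.
  HasDimension : ∀ {n p} → Pred (Vector Carrier n) p → ℕ → Set (c ⊔ ℓ₁ ⊔ p)
  HasDimension {n} W d = ∃[ b ] IsBasis {d} {n} W b

  module I⊖J-Inverse where
    open RingProperties ring
    open HCRProperties heytingCommutativeRing
      using (1#0; #-congʳ; x-0≈x)
    open SemiringMult semiring using (×-homo-1)
    open SetoidReasoning setoid
    module < = IsStrictPartialOrder isStrictPartialOrder

    +-positive : ∀ {x y} → 0# < x → 0# < y → 0# < x + y
    +-positive {x} {y} 0<x 0<y =
      <.trans 0<y (<.<-respˡ-≈ (+-identityˡ y) (+-monoˡ-< y 0<x))

    0<1 : 0# < 1#
    0<1 with #⇒<⊎> 1#0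
    ... | inj₂ 0<1 = 0<1
    ... | inj₁ 1<0 = <.<-respʳ-≈ [-1]²≈1 (*-positive 0<-1 0<-1)
      where
      0<-1 : 0# < - 1#
      0<-1 = <.<-respʳ-≈ (+-identityˡ (- 1#))
               (<.<-respˡ-≈ (-‿inverseʳ 1#) (+-monoˡ-< (- 1#) 1<0))
      [-1]²≈1 : - 1# * - 1# ≈ 1#
      [-1]²≈1 = trans (-1*x≈-x (- 1#)) (-‿involutive 1#)

    suc·1-positive : ∀ n → 0# < ℕ.suc n · 1#
    suc·1-positive ℕ.zero    = <.<-respʳ-≈ (sym (×-homo-1 1#)) 0<1
    suc·1-positive (ℕ.suc n) = +-positive 0<1 (suc·1-positive n)

    I-sym : ∀ n i j → I n i j ≈ I n j i
    I-sym n i j with i Fin.≟ j | j Fin.≟ i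
    ... | yes _  | yes _  = refl
    ... | no _   | no _   = refl
    ... | yes ij | no ¬ji = contradiction (≡.sym ij) ¬ji
    ... | no ¬ij | yes ji = contradiction (≡.sym ji) ¬ij

    I-suc : ∀ n i j → I (ℕ.suc n) (suc i) (suc j) ≈ I n i j
    I-suc n i j with i Fin.≟ j
    ... | yes _ = refl
    ... | no _  = refl

    sum-I : ∀ n i (f : Vector Carrier n) → ∑[ l < n ] (I n i l * f l) ≈ f i
    sum-I (ℕ.suc n) zero f = begin
      1# * f zero + ∑[ l < n ] (0# * f (suc l))
        ≈⟨ +-cong (*-identityˡ _) (sum-cong-≋ λ l → zeroˡ (f (suc l))) ⟩
      f zero + ∑[ l < n ] 0#  ≈⟨ +-congˡ (sum-replicate-zero n) ⟩
      f zero + 0#             ≈⟨ +-identityʳ _ ⟩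
      f zero                  ∎
    sum-I (ℕ.suc n) (suc i) f = begin
      0# * f zero + ∑[ l < n ] (I (ℕ.suc n) (suc i) (suc l) * f (suc l))
        ≈⟨ +-cong (zeroˡ _) (sum-cong-≋ λ l → *-congʳ {f (suc l)} (I-suc n i l)) ⟩
      0# + ∑[ l < n ] (I n i l * f (suc l))  ≈⟨ +-identityˡ _ ⟩
      ∑[ l < n ] (I n i l * f (suc l))       ≈⟨ sum-I n i (f ∘ suc) ⟩
      f (suc i)                              ∎

    module _ (m : ℕ) where
      n : ℕ
      n = ℕ.suc (ℕ.suc m)

      d : Carrier
      d = ℕ.suc m · 1#

      d⁻¹ : ∃[ x ] d * x ≈ 1#
      d⁻¹ with #⇒invertible (#-sym (<⇒# (suc·1-positive m)))
      ... | x , _ , dx≈1 = x , trans (*-congʳ (sym (x-0≈x d))) dx≈1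

      a : Carrier
      a = - proj₁ d⁻¹

      -- (I − J)⁻¹ = I − (n − 1)⁻¹ J
      B : Matrix n n
      B i j = I n i j + a

      sum-B : ∀ j → ∑[ l < n ] B l j ≈ a
      sum-B j = begin
        ∑[ l < n ] (I n l j + a)
          ≈⟨ ∑-distrib-+ (λ l → I n l j) (λ _ → a) ⟩
        ∑[ l < n ] I n l j + ∑[ l < n ] a
          ≈⟨ +-cong (sum-cong-≋ λ l → trans (I-sym n l j) (sym (*-identityʳ (I n j l))))
                    (sum-cong-≋ {n} λ l → sym (*-identityˡ a)) ⟩
        ∑[ l < n ] (I n j l * 1#) + ∑[ l < n ] (1# * a)
          ≈⟨ +-cong (sum-I n j (λ _ → 1#)) (sym (*-distribʳ-sum a (λ (_ : Fin n) → 1#))) ⟩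
        1# + ∑[ l < n ] 1# * a  ≈⟨ +-congˡ (*-congʳ (sum-replicate n)) ⟩
        1# + (1# + d) * a       ≈⟨ +-congˡ (distribʳ a 1# d) ⟩
        1# + (1# * a + d * a)
          ≈⟨ +-congˡ (+-cong (*-identityˡ a)
               (trans (sym (-‿distribʳ-* d _)) (-‿cong (proj₂ d⁻¹)))) ⟩
        1# + (a - 1#)           ≈⟨ +-comm _ _ ⟩
        (a - 1#) + 1#           ≈⟨ +-assoc _ _ _ ⟩
        a + (- 1# + 1#)         ≈⟨ +-congˡ (-‿inverseˡ 1#) ⟩
        a + 0#                  ≈⟨ +-identityʳ a ⟩
        a                       ∎

      right : (I n ⊖ J n) ⊗ B ≋ₘ I n
      right i j = begin
        ∑[ l < n ] ((I n i l - 1#) * B l j)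
          ≈⟨ sum-cong-≋ (λ l → distribʳ (B l j) (I n i l) (- 1#)) ⟩
        ∑[ l < n ] (I n i l * B l j + - 1# * B l j)
          ≈⟨ ∑-distrib-+ (λ l → I n i l * B l j) (λ l → - 1# * B l j) ⟩
        ∑[ l < n ] (I n i l * B l j) + ∑[ l < n ] (- 1# * B l j)
          ≈⟨ +-cong (sum-I n i (λ l → B l j)) (sym (*-distribˡ-sum (- 1#) (λ l → B l j))) ⟩
        B i j + - 1# * ∑[ l < n ] B l j
          ≈⟨ +-congˡ (trans (-1*x≈-x _) (-‿cong (sum-B j))) ⟩
        I n i j + a - a      ≈⟨ +-assoc _ _ _ ⟩
        I n i j + (a - a)    ≈⟨ +-congˡ (-‿inverseʳ a) ⟩
        I n i j + 0#         ≈⟨ +-identityʳ _ ⟩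
        I n i j              ∎

      left : B ⊗ (I n ⊖ J n) ≋ₘ I n
      left i j = begin
        ∑[ l < n ] (B i l * (I n l j - 1#))
          ≈⟨ sum-cong-≋ (λ l → trans (*-comm (B i l) (I n l j - 1#))
               (*-cong (+-congʳ (I-sym n l j)) (+-congʳ (I-sym n i l)))) ⟩
        ∑[ l < n ] ((I n j l - 1#) * B l i)  ≈⟨ right j i ⟩
        I n j i                              ≈⟨ I-sym n j i ⟩
        I n i j                              ∎

  I⊖J-invertible : ∀ {n} → 2 ℕ.≤ n → Invertible (I n ⊖ J n)
  I⊖J-invertible {ℕ.suc (ℕ.suc m)} (s≤s (s≤s z≤n)) =
    I⊖J-Inverse.B m , I⊖J-Inverse.right m , I⊖J-Inverse.left m

record Graph : Set₁ where
  infix 4 _~_ _~?_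
  field
    Vertex   : Set
    _~_      : Rel Vertex 0ℓ
    _~?_     : Decidable _~_
    ~-sym    : Symmetric _~_
    ~-irrefl : ∀ {v} → ¬ v ~ v

-- An s-partition (K,S) together with enumerations of K and of S; these fix the
-- order of the rows and columns of the matrices below.  The bijection says that
-- the (hence finite) vertex set is the disjoint union of K and S.
record SPartition (G : Graph) : Set where
  open Graph G
  field
    ∣K∣ ∣S∣     : ℕ
    vertex      : (Fin ∣K∣ ⊎ Fin ∣S∣) ↔ Vertex
    K-nonempty  : NonZero ∣K∣
    S-nonempty  : NonZero ∣S∣

  open Inverse vertex using (to; from)

  kᵥ : Fin ∣K∣ → Vertex
  kᵥ = to ∘ inj₁

  sᵥ : Fin ∣S∣ → Vertex
  sᵥ = to ∘ inj₂

  field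
    clique      : ∀ {i j} → i ≢ j → kᵥ i ~ kᵥ j
    independent : ∀ {i j} → ¬ sᵥ i ~ sᵥ j

  K : Pred Vertex 0ℓ
  K v = ∃[ i ] kᵥ i ≡ v

  vertexAt : Fin (∣K∣ ℕ.+ ∣S∣) → Vertex
  vertexAt = to ∘ splitAt ∣K∣

  position : Vertex → Fin (∣K∣ ℕ.+ ∣S∣)
  position = join ∣K∣ ∣S∣ ∘ from

module SplitGraph {c ℓ₁ ℓ₂ ℓ₃} (ℝ : Reals c ℓ₁ ℓ₂ ℓ₃)
                  {G : Graph} (Sp : SPartition G) where
  open Reals ℝ using (Carrier; _#_; 0#)
  open LinearAlgebra ℝ
  open Graph G
  open SPartition Sp

  adjacency : Matrix (∣K∣ ℕ.+ ∣S∣) (∣K∣ ℕ.+ ∣S∣)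
  adjacency i j = indicator (vertexAt i ~? vertexAt j)

  R : Matrix ∣K∣ ∣S∣
  R i j = indicator (kᵥ i ~? sᵥ j)

  Supp : Pred Vertex (c ⊔ ℓ₁ ⊔ ℓ₂)
  Supp v = ∃[ x ] x ∈ 𝒩 adjacency × x (position v) # 0#

  Cker : 2 ℕ.≤ ∣K∣ → Pred (Vector Carrier ∣K∣) (c ⊔ ℓ₁)
  Cker 2≤∣K∣ = 𝒩 (R ᵀ) ∩ im (inverse (I⊖J-invertible 2≤∣K∣) ⊗ R)

{-# OPTIONS --safe #-}

-- Eliminating the K-block of A(Sp)(x,y) = 0 with (I − J)⁻¹ identifies the
-- K-parts of null vectors with Cker(Sp), so Cker(Sp) ≠ {0} already makes
-- Supp(Sp) ∩ K inhabited.  For x ∈ Cker(Sp), pairing (I − J)x = Ry with x and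
-- using Rᵗx = 0 gives Σ xᵢ² = (Σ xᵢ)².  Hence x ↦ Σ xᵢ is injective on
-- Cker(Sp), so Cker(Sp) ≠ {0} also forces dim Cker(Sp) = 1.

module Submission where

open import Defs
open import Algebra.Bundles using (CommutativeRing)
import Algebra.Apartness.Properties.HeytingCommutativeRing as HCRProperties
import Algebra.Properties.CommutativeSemigroup as CommutativeSemigroupProperties
import Algebra.Properties.Ring as RingProperties
import Algebra.Properties.Semiring.Sum as SemiringSum
open import Data.Bool.Base using (if_then_else_)
open import Data.Fin.Base using (Fin; zero; suc; _↑ˡ_; _↑ʳ_; join; splitAt)
import Data.Fin.Properties as Fin
open import Data.Nat.Base as ℕ using (ℕ; _≤_)
open import Data.Product.Base using (∃-syntax; _,_; proj₁; proj₂)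
open import Data.Sum.Base using (inj₁; inj₂; [_,_]′)
open import Data.Vec.Functional using (Vector; _++_)
open import Data.Vec.Functional.Properties using (lookup-++ˡ; lookup-++ʳ)
import Data.Vec.Functional.Relation.Binary.Equality.Setoid as VectorEquality
open import Function.Base using (_∘_)
open import Function.Bundles using (_⇔_; mk⇔; Inverse)
open import Relation.Binary.PropositionalEquality as ≡ using (_≡_)
import Relation.Binary.Reasoning.Setoid as SetoidReasoning
open import Relation.Binary.Structures using (IsStrictPartialOrder)
open import Relation.Nullary using (¬_; Dec; yes; no; contradiction)
open import Relation.Nullary.Decidable using (does-⇔)
open import Relation.Unary using (Pred; Satisfiable; _∈_; _∩_)

module _ {c ℓ₁ ℓ₂ ℓ₃} (ℝ : Reals c ℓ₁ ℓ₂ ℓ₃) where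
  open Reals ℝ hiding (zero)
  open LinearAlgebra ℝ
  open I⊖J-Inverse using (sum-I)
  open SemiringSum semiring
  open RingProperties ring
  open HCRProperties heytingCommutativeRing using (x-0≈x; #-congʳ)
  open CommutativeRing commutativeRing using (*-commutativeSemigroup)
  open CommutativeSemigroupProperties *-commutativeSemigroup using (x∙yz≈y∙xz)
  open VectorEquality setoid using (_≋_; ≋-sym; ≋-trans)
  open SetoidReasoning setoid
  private module < = IsStrictPartialOrder isStrictPartialOrder

  -- Signs and squares in an ordered field with tight apartness.

  ¬#⇒≈ : ∀ {x y} → ¬ x # y → x ≈ y
  ¬#⇒≈ = proj₁ (tight _ _)

  #0⇒inverse : ∀ {x} → x # 0# → ∃[ u ] u * x ≈ 1#
  #0⇒inverse {x} x#0 with #⇒invertible x#0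
  ... | u , u[x-0]≈1 , _ = u , trans (*-congˡ (sym (x-0≈x x))) u[x-0]≈1

  +-inverse-negative : ∀ {x} → x < 0# → 0# < - x
  +-inverse-negative {x} x<0 =
    <.<-respʳ-≈ (+-identityˡ (- x))
      (<.<-respˡ-≈ (-‿inverseʳ x) (+-monoˡ-< (- x) x<0))

  square-positive : ∀ {x} → x # 0# → 0# < x * x
  square-positive {x} x#0 with #⇒<⊎> x#0
  ... | inj₂ 0<x = *-positive 0<x 0<x
  ... | inj₁ x<0 = <.<-respʳ-≈ [-x]²≈x² (*-positive 0<-x 0<-x)
    where
    0<-x = +-inverse-negative x<0
    [-x]²≈x² : - x * - x ≈ x * x
    [-x]²≈x² = begin
      - x * - x      ≈⟨ -‿distribʳ-* (- x) x ⟨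
      - (- x * x)    ≈⟨ -‿cong (-‿distribˡ-* x x) ⟨
      - (- (x * x))  ≈⟨ -‿involutive (x * x) ⟩
      x * x          ∎

  -- Nonnegativity is the negation of `_<_` to `0#`. A negative square rules out `x # 0#`, so
  -- tightness gives `x ≈ 0#`, and then the square is zero after all.
  square-nonnegative : ∀ x → ¬ x * x < 0#
  square-nonnegative x x²<0 = <.irrefl (trans (*-congʳ x≈0) (zeroˡ x)) x²<0
    where
    x≈0 : x ≈ 0#
    x≈0 = ¬#⇒≈ λ x#0 → <.asym x²<0 (square-positive x#0)

  -- The order is not decidable: cotransitivity of # replaces the case split
  -- on the sign of y.
  positive+nonnegative : ∀ {x y} → 0# < x → ¬ y < 0# → 0# < x + y
  positive+nonnegative {x} {y} 0<x y≮0 with #-cotrans (<⇒# 0<x) (x + y)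
  ... | inj₁ 0#x+y with #⇒<⊎> 0#x+y
  ...   | inj₁ 0<x+y = 0<x+y
  ...   | inj₂ x+y<0 = contradiction
    (<.trans (<.<-respˡ-≈ (+-identityˡ y) (+-monoˡ-< y 0<x)) x+y<0) y≮0
  positive+nonnegative {x} {y} 0<x y≮0 | inj₂ x+y#x with #⇒<⊎> x+y#x
  ... | inj₂ x<x+y = <.trans 0<x x<x+y
  ... | inj₁ x+y<x = contradiction
    (<.<-respˡ-≈ x+y-x≈y (<.<-respʳ-≈ (-‿inverseʳ x) (+-monoˡ-< (- x) x+y<x))) y≮0
    where
    x+y-x≈y : x + y - x ≈ y
    x+y-x≈y = xyx⁻¹≈y x y

  -- Suppose the sum is negative. Then `x` cannot be apart from zero, since it would be positive and
  -- make the sum positive; so `x ≈ 0#`, and `y` itself would be negative.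
  nonnegative+nonnegative : ∀ {x y} → ¬ x < 0# → ¬ y < 0# → ¬ x + y < 0#
  nonnegative+nonnegative {x} {y} x≮0 y≮0 x+y<0 =
    y≮0 (<.<-respˡ-≈ (trans (+-congʳ x≈0) (+-identityˡ y)) x+y<0)
    where
    x≈0 : x ≈ 0#
    x≈0 = ¬#⇒≈ λ x#0 → [ x≮0
                       , (λ 0<x → <.asym x+y<0 (positive+nonnegative 0<x y≮0))
                       ]′ (#⇒<⊎> x#0)

  -- The dot product and its definiteness.

  infix 8 _∙_
  _∙_ : ∀ {n} → Vector Carrier n → Vector Carrier n → Carrier
  x ∙ y = ∑[ i < _ ] (x i * y i)

  ∙-nonnegative : ∀ {n} (x : Vector Carrier n) → ¬ x ∙ x < 0#
  ∙-nonnegative {ℕ.zero}  x = <.irrefl refl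
  ∙-nonnegative {ℕ.suc n} x =
    nonnegative+nonnegative (square-nonnegative (x zero)) (∙-nonnegative (x ∘ suc))

  ∙-positive : ∀ {n} (x : Vector Carrier n) i → x i # 0# → 0# < x ∙ x
  ∙-positive x zero    x₀#0 =
    positive+nonnegative (square-positive x₀#0) (∙-nonnegative (x ∘ suc))
  ∙-positive x (suc i) xᵢ#0 = <.<-respʳ-≈ (+-comm _ _)
    (positive+nonnegative (∙-positive (x ∘ suc) i xᵢ#0) (square-nonnegative (x zero)))

  -- An entry apart from zero would make `x ∙ x` positive; tightness turns this refutation into
  -- equality with zero.
  ∙-definite : ∀ {n} (x : Vector Carrier n) → x ∙ x ≈ 0# → x ≋ 𝟎
  ∙-definite x x∙x≈0 i = ¬#⇒≈ λ xᵢ#0 → <.irrefl (sym x∙x≈0) (∙-positive x i xᵢ#0)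

  -- Linear combinations, matrix products and the quadratic form of `I − J`.

  sum-++ : ∀ m {n} (f : Vector Carrier (m ℕ.+ n)) →
           sum f ≈ ∑[ i < m ] f (i ↑ˡ n) + ∑[ j < n ] f (m ↑ʳ j)
  sum-++ ℕ.zero    f = sym (+-identityˡ _)
  sum-++ (ℕ.suc m) f = trans (+-congˡ (sum-++ m (f ∘ suc))) (sym (+-assoc _ _ _))

  lincomb : ∀ {n} → Carrier → Vector Carrier n → Carrier → Vector Carrier n →
            Vector Carrier n
  lincomb a x b y i = a * x i + b * y i

  sum-lincomb : ∀ {n} a (x : Vector Carrier n) b y →
                sum (lincomb a x b y) ≈ a * sum x + b * sum y
  sum-lincomb a x b y = trans (∑-distrib-+ (λ i → a * x i) (λ i → b * y i))
    (+-cong (sym (*-distribˡ-sum a x)) (sym (*-distribˡ-sum b y)))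

  ⊛-lincomb : ∀ {m n} (A : Matrix m n) a x b y →
              A ⊛ lincomb a x b y ≋ lincomb a (A ⊛ x) b (A ⊛ y)
  ⊛-lincomb A a x b y i = trans
    (sum-cong-≋ λ j → trans (distribˡ (A i j) (a * x j) (b * y j))
      (+-cong (x∙yz≈y∙xz (A i j) a (x j)) (x∙yz≈y∙xz (A i j) b (y j))))
    (sum-lincomb a (λ j → A i j * x j) b (λ j → A i j * y j))

  ⊛-congˡ : ∀ {m n} (A : Matrix m n) {x y} → x ≋ y → A ⊛ x ≋ A ⊛ y
  ⊛-congˡ A x≋y i = sum-cong-≋ λ j → *-congˡ (x≋y j)

  ⊛-congʳ : ∀ {m n} {A B : Matrix m n} x → A ≋ₘ B → A ⊛ x ≋ B ⊛ x
  ⊛-congʳ x A≋B i = sum-cong-≋ λ j → *-congʳ (A≋B i j)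

  lincomb-cong : ∀ {n} a {x x′ : Vector Carrier n} b {y y′} →
                 x ≋ x′ → y ≋ y′ → lincomb a x b y ≋ lincomb a x′ b y′
  lincomb-cong a b x≋x′ y≋y′ i = +-cong (*-congˡ (x≋x′ i)) (*-congˡ (y≋y′ i))

  lincomb-𝟎 : ∀ {n} a b → lincomb {n} a 𝟎 b 𝟎 ≋ 𝟎
  lincomb-𝟎 a b i = trans (+-cong (zeroʳ a) (zeroʳ b)) (+-identityˡ 0#)

  ⊗-⊛-assoc : ∀ {l m n} (A : Matrix l m) (B : Matrix m n) x →
              (A ⊗ B) ⊛ x ≋ A ⊛ (B ⊛ x)
  ⊗-⊛-assoc {l} {m} {n} A B x i = begin
    ∑[ k < n ] (∑[ j < m ] (A i j * B j k) * x k)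
      ≈⟨ sum-cong-≋ (λ k → *-distribʳ-sum (x k) (λ j → A i j * B j k)) ⟩
    ∑[ k < n ] ∑[ j < m ] (A i j * B j k * x k)
      ≈⟨ ∑-comm (λ k j → A i j * B j k * x k) ⟩
    ∑[ j < m ] ∑[ k < n ] (A i j * B j k * x k)
      ≈⟨ sum-cong-≋ (λ j → sum-cong-≋ λ k → *-assoc (A i j) (B j k) (x k)) ⟩
    ∑[ j < m ] ∑[ k < n ] (A i j * (B j k * x k))
      ≈⟨ sum-cong-≋ (λ j → *-distribˡ-sum (A i j) (λ k → B j k * x k)) ⟨
    ∑[ j < m ] (A i j * ∑[ k < n ] (B j k * x k))  ∎

  ∙-adjoint : ∀ {m n} (A : Matrix m n) x y → x ∙ (A ⊛ y) ≈ (A ᵀ ⊛ x) ∙ y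
  ∙-adjoint A x y = begin
    x ∙ (A ⊛ y)
      -- Reading `x` as a one-row matrix turns the pairing into an instance of associativity.
      ≈⟨ ⊗-⊛-assoc (λ (_ : Fin 1) → x) A y zero ⟨
    ∑[ j < _ ] (∑[ i < _ ] (x i * A i j) * y j)
      ≈⟨ sum-cong-≋ (λ j → *-congʳ {y j} (sum-cong-≋ λ i → *-comm (x i) (A i j))) ⟩
    (A ᵀ ⊛ x) ∙ y  ∎

  inverse-⊛ : ∀ {n} {A : Matrix n n} (A⁻¹ : Invertible A) {x y} →
              inverse {A = A} A⁻¹ ⊛ y ≋ x → A ⊛ x ≋ y
  inverse-⊛ {n} {A} (B , AB≋I , _) {x} {y} By≋x i = begin
    (A ⊛ x) i        ≈⟨ ⊛-congˡ A By≋x i ⟨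
    (A ⊛ (B ⊛ y)) i  ≈⟨ ⊗-⊛-assoc A B y i ⟨
    ((A ⊗ B) ⊛ y) i  ≈⟨ ⊛-congʳ y AB≋I i ⟩
    (I n ⊛ y) i      ≈⟨ sum-I n i y ⟩
    y i              ∎

  I⊖J-⊛ : ∀ {n} (x : Vector Carrier n) i → ((I n ⊖ J n) ⊛ x) i ≈ x i - sum x
  I⊖J-⊛ {n} x i = begin
    ∑[ j < n ] ((I n i j - 1#) * x j)
      ≈⟨ sum-cong-≋ (λ j → distribʳ (x j) (I n i j) (- 1#)) ⟩
    ∑[ j < n ] (I n i j * x j + - 1# * x j)
      ≈⟨ ∑-distrib-+ (λ j → I n i j * x j) (λ j → - 1# * x j) ⟩
    ∑[ j < n ] (I n i j * x j) + ∑[ j < n ] (- 1# * x j)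
      ≈⟨ +-cong (sum-I n i x) (sym (*-distribˡ-sum (- 1#) x)) ⟩
    x i + - 1# * sum x
      ≈⟨ +-congˡ (-1*x≈-x (sum x)) ⟩
    x i - sum x  ∎

  -- Every entry of `J ⊛ x` is `sum x`, so pairing it with `x` contributes the square of the sum.
  ∙-I⊖J : ∀ {n} (x : Vector Carrier n) →
          x ∙ ((I n ⊖ J n) ⊛ x) ≈ x ∙ x - sum x * sum x
  ∙-I⊖J {n} x = begin
    ∑[ i < n ] (x i * ((I n ⊖ J n) ⊛ x) i)
      ≈⟨ sum-cong-≋ (λ i → trans (*-congˡ (I⊖J-⊛ x i)) (distribˡ (x i) (x i) (- sum x))) ⟩
    ∑[ i < n ] (x i * x i + x i * - sum x)
      ≈⟨ ∑-distrib-+ (λ i → x i * x i) (λ i → x i * - sum x) ⟩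
    x ∙ x + ∑[ i < n ] (x i * - sum x)
      ≈⟨ +-congˡ (*-distribʳ-sum (- sum x) x) ⟨
    x ∙ x + sum x * - sum x
      ≈⟨ +-congˡ (-‿distribʳ-* (sum x) (sum x)) ⟨
    x ∙ x - sum x * sum x  ∎

  -- Subspaces and the criterion for dimension one.

  𝒩-lincomb : ∀ {m n} (A : Matrix m n) a b {x y} →
              x ∈ 𝒩 A → y ∈ 𝒩 A → lincomb a x b y ∈ 𝒩 A
  𝒩-lincomb A a b {x} {y} Ax≋𝟎 Ay≋𝟎 = ≋-trans (⊛-lincomb A a x b y)
    (≋-trans (lincomb-cong a b Ax≋𝟎 Ay≋𝟎) (lincomb-𝟎 a b))

  im-lincomb : ∀ {m n} (A : Matrix m n) a b {x y} →
               x ∈ im A → y ∈ im A → lincomb a x b y ∈ im A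
  im-lincomb A a b (u , Au≋x) (v , Av≋y) =
    lincomb a u b v , ≋-trans (⊛-lincomb A a u b v) (lincomb-cong a b Au≋x Av≋y)

  -- By `norm`, a vector of `W` whose entries sum to zero has zero length and vanishes. Thus `sum`
  -- embeds `W` into a line, and the given nonzero `w` is a basis.
  one-dimensional :
    ∀ {n p} {W : Pred (Vector Carrier n) p} →
    (∀ a b {x y} → x ∈ W → y ∈ W → lincomb a x b y ∈ W) →
    (∀ {x} → x ∈ W → x ∙ x ≈ sum x * sum x) →
    Nonzero W → HasDimension W 1
  one-dimensional {n} {W = W} closed norm (w , w∈W , i , wᵢ#0) = (λ _ → w) , record
    { member      = λ _ → w∈W
    ; independent = independent
    ; spanning    = λ {x} x∈W → (λ _ → proj₁ 1/∑w * sum x) , spanning x∈W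
    }
    where
    1/∑w : ∃[ u ] u * sum w ≈ 1#
    -- `w ∙ w` is positive and equals the square of `sum w`; an inverse `u` of that square yields
    -- `u * sum w` as an inverse of `sum w`.
    1/∑w with #0⇒inverse (#-sym (<⇒# (<.<-respʳ-≈ (norm w∈W) (∙-positive w i wᵢ#0))))
    ... | u , u∑w²≈1 = u * sum w , trans (*-assoc u (sum w) (sum w)) u∑w²≈1

    independent : LinearlyIndependent {1} λ _ → w
    independent a aw≋𝟎 zero with #0⇒inverse wᵢ#0
    ... | u , uwᵢ≈1 = begin
      a zero              ≈⟨ *-identityʳ _ ⟨
      a zero * 1#         ≈⟨ *-congˡ uwᵢ≈1 ⟨
      a zero * (u * w i)  ≈⟨ x∙yz≈y∙xz (a zero) u (w i) ⟩
      -- The `0#` removed here is the empty tail of the one-term sum in `combination`.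
      u * (a zero * w i)  ≈⟨ *-congˡ (trans (sym (+-identityʳ _)) (aw≋𝟎 i)) ⟩
      u * 0#              ≈⟨ zeroʳ u ⟩
      0#                  ∎

    spanning : ∀ {x} → x ∈ W →
               combination {1} (λ _ → proj₁ 1/∑w * sum x) (λ _ → w) ≋ x
    spanning {x} x∈W j = begin
      u * sum x * w j + 0#  ≈⟨ +-identityʳ _ ⟩
      u * sum x * w j       ≈⟨ *-assoc u (sum x) (w j) ⟩
      u * (sum x * w j)     ≈⟨ *-congˡ ∑w*xⱼ≈∑x*wⱼ ⟨
      u * (sum w * x j)     ≈⟨ *-assoc u (sum w) (x j) ⟨
      u * sum w * x j       ≈⟨ *-congʳ (proj₂ 1/∑w) ⟩
      1# * x j              ≈⟨ *-identityˡ (x j) ⟩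
      x j                   ∎
      where
      u : Carrier
      u = proj₁ 1/∑w

      v : Vector Carrier n
      -- The coefficients are chosen to cancel the two sums, so that `v` is a vector of `W` with sum
      -- zero.
      v = lincomb (sum w) x (- sum x) w

      ∑v≈0 : sum v ≈ 0#
      ∑v≈0 = begin
        sum v                                ≈⟨ sum-lincomb (sum w) x (- sum x) w ⟩
        sum w * sum x + - sum x * sum w      ≈⟨ +-congˡ (-‿distribˡ-* (sum x) (sum w)) ⟨
        sum w * sum x - sum x * sum w        ≈⟨ +-congʳ (*-comm (sum w) (sum x)) ⟩
        sum x * sum w - sum x * sum w        ≈⟨ -‿inverseʳ _ ⟩
        0#                                   ∎

      v≋𝟎 : v ≋ 𝟎
      v≋𝟎 = ∙-definite v (trans (norm (closed (sum w) (- sum x) x∈W w∈W))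
                                (trans (*-congʳ ∑v≈0) (zeroˡ (sum v))))

      ∑w*xⱼ≈∑x*wⱼ : sum w * x j ≈ sum x * w j
      ∑w*xⱼ≈∑x*wⱼ = x∙y⁻¹≈ε⇒x≈y _ _
        (trans (+-congˡ (-‿distribˡ-* (sum x) (w j))) (v≋𝟎 j))

  -- Block form of the adjacency matrix and its null vectors.

  indicator-⇔ : ∀ {p q} {P : Set p} {Q : Set q} (P? : Dec P) (Q? : Dec Q) →
                P ⇔ Q → indicator P? ≡ indicator Q?
  indicator-⇔ P? Q? P⇔Q = ≡.cong (if_then 1# else 0#) (does-⇔ P⇔Q P? Q?)

  module _ {G : Graph} (Sp : SPartition G) where
    open Graph G
    open SPartition Sp
    open SplitGraph ℝ Sp
    open Inverse vertex using (to; strictlyInverseʳ)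

    -- The clique block is `J − I`, whereas the clique-kernel is built from `I − J`; hence the sign.
    KK-entry : ∀ i j → indicator (kᵥ i ~? kᵥ j) ≈ - (I ∣K∣ ⊖ J ∣K∣) i j
    KK-entry i j with i Fin.≟ j | kᵥ i ~? kᵥ j
    ... | yes _      | no _    = sym (trans (-‿cong (-‿inverseʳ 1#)) -0#≈0#)
    ... | yes ≡.refl | yes k~k = contradiction k~k ~-irrefl
    ... | no _       | yes _   =
      sym (trans (-‿cong (+-identityˡ _)) (-‿involutive 1#))
    ... | no i≢j     | no ≁    = contradiction (clique i≢j) ≁

    -- The two orders of a pair are decided separately, so the entries are matched through symmetry
    -- of `_~_`.
    SK-entry : ∀ i j → indicator (sᵥ i ~? kᵥ j) ≡ (R ᵀ) i j
    SK-entry i j = indicator-⇔ (sᵥ i ~? kᵥ j) (kᵥ j ~? sᵥ i) (mk⇔ ~-sym ~-sym)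

    SS-entry : ∀ i j → indicator (sᵥ i ~? sᵥ j) ≈ 0#
    SS-entry i j with sᵥ i ~? sᵥ j
    ... | no _    = refl
    ... | yes s~s = contradiction s~s independent

    vertexAt-↑ˡ : ∀ i → vertexAt (i ↑ˡ ∣S∣) ≡ kᵥ i
    vertexAt-↑ˡ i = ≡.cong to (Fin.splitAt-↑ˡ ∣K∣ i ∣S∣)

    vertexAt-↑ʳ : ∀ j → vertexAt (∣K∣ ↑ʳ j) ≡ sᵥ j
    vertexAt-↑ʳ j = ≡.cong to (Fin.splitAt-↑ʳ ∣K∣ ∣S∣ j)

    -- A row of the block product indexed by its vertex instead of its position, so that rows can be
    -- treated by cases on `K` and `S`.
    vertexRow : Vertex → Vector Carrier ∣K∣ → Vector Carrier ∣S∣ → Carrier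
    vertexRow v x y = ∑[ i < ∣K∣ ] (indicator (v ~? kᵥ i) * x i) +
                      ∑[ j < ∣S∣ ] (indicator (v ~? sᵥ j) * y j)

    adjacency-⊛-++ : ∀ x y i → (adjacency ⊛ (x ++ y)) i ≈ vertexRow (vertexAt i) x y
    adjacency-⊛-++ x y i = trans (sum-++ ∣K∣ _) (+-cong
      (sum-cong-≋ λ k → reflexive (≡.cong₂ _*_
        (≡.cong (λ v → indicator (vertexAt i ~? v)) (vertexAt-↑ˡ k)) (lookup-++ˡ x y k)))
      (sum-cong-≋ λ s → reflexive (≡.cong₂ _*_
        (≡.cong (λ v → indicator (vertexAt i ~? v)) (vertexAt-↑ʳ s)) (lookup-++ʳ x y s))))

    -- A row from `K` reads `−(I − J)x + Ry` and a row from `S` reads `Rᵀx`; the two hypotheses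
    -- annihilate them.
    vertexRow≈0 : ∀ {x y} → (I ∣K∣ ⊖ J ∣K∣) ⊛ x ≋ R ⊛ y → x ∈ 𝒩 (R ᵀ) →
                  ∀ p → vertexRow (to p) x y ≈ 0#
    vertexRow≈0 {x} {y} [I-J]x≋Ry _ (inj₁ i) = begin
      vertexRow (kᵥ i) x y
        ≈⟨ +-congʳ (sum-cong-≋ λ k → trans (*-congʳ {x k} (KK-entry i k))
             (trans (sym (-‿distribˡ-* _ (x k))) (sym (-1*x≈-x _)))) ⟩
      ∑[ k < ∣K∣ ] (- 1# * ((I ∣K∣ ⊖ J ∣K∣) i k * x k)) + (R ⊛ y) i
        ≈⟨ +-congʳ (*-distribˡ-sum (- 1#) (λ k → (I ∣K∣ ⊖ J ∣K∣) i k * x k)) ⟨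
      - 1# * ((I ∣K∣ ⊖ J ∣K∣) ⊛ x) i + (R ⊛ y) i
        ≈⟨ +-congʳ (trans (-1*x≈-x _) (-‿cong ([I-J]x≋Ry i))) ⟩
      - (R ⊛ y) i + (R ⊛ y) i
        ≈⟨ -‿inverseˡ _ ⟩
      0#  ∎
    vertexRow≈0 {x} {y} _ Rᵀx≋𝟎 (inj₂ j) = begin
      vertexRow (sᵥ j) x y
        ≈⟨ +-cong (sum-cong-≋ λ k → *-congʳ {x k} (reflexive (SK-entry j k)))
             (sum-cong-≋ λ s → trans (*-congʳ {y s} (SS-entry j s)) (zeroˡ (y s))) ⟩
      (R ᵀ ⊛ x) j + ∑[ s < ∣S∣ ] 0#
        ≈⟨ +-cong (Rᵀx≋𝟎 j) (sum-replicate-zero ∣S∣) ⟩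
      0# + 0#
        ≈⟨ +-identityˡ 0# ⟩
      0#  ∎

    position-kᵥ : ∀ i → position (kᵥ i) ≡ i ↑ˡ ∣S∣
    position-kᵥ i = ≡.cong (join ∣K∣ ∣S∣) (strictlyInverseʳ (inj₁ i))

    -- The clique-kernel: its norm identity and its null vectors.

    module _ (2≤∣K∣ : 2 ≤ ∣K∣) where

      -- Multiplying by `I − J` clears the inverse, leaving the equation that the rows from `K`
      -- impose.
      Cker⇒clique-equation : ∀ {x y} →
        (inverse {A = I ∣K∣ ⊖ J ∣K∣} (I⊖J-invertible 2≤∣K∣) ⊗ R) ⊛ y ≋ x →
        (I ∣K∣ ⊖ J ∣K∣) ⊛ x ≋ R ⊛ y
      Cker⇒clique-equation {y = y} BRy≋x = inverse-⊛ I-J⁻¹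
        (≋-trans (≋-sym (⊗-⊛-assoc (inverse {A = I ∣K∣ ⊖ J ∣K∣} I-J⁻¹) R y)) BRy≋x)
        where I-J⁻¹ = I⊖J-invertible 2≤∣K∣

      Cker-lincomb : ∀ a b {x y} → x ∈ Cker 2≤∣K∣ → y ∈ Cker 2≤∣K∣ →
                     lincomb a x b y ∈ Cker 2≤∣K∣
      Cker-lincomb a b (x∈𝒩 , x∈im) (y∈𝒩 , y∈im) =
        𝒩-lincomb (R ᵀ) a b x∈𝒩 y∈𝒩 , im-lincomb _ a b x∈im y∈im

      -- The quadratic form of `I − J` vanishes at `x`: it equals `x ∙ Ry`, and moving `R` across
      -- the product gives `Rᵀx = 0`.
      Cker-norm : ∀ {x} → x ∈ Cker 2≤∣K∣ → x ∙ x ≈ sum x * sum x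
      Cker-norm {x} (Rᵀx≋𝟎 , y , BRy≋x) = x∙y⁻¹≈ε⇒x≈y _ _ (begin
        x ∙ x - sum x * sum x
          ≈⟨ ∙-I⊖J x ⟨
        x ∙ ((I ∣K∣ ⊖ J ∣K∣) ⊛ x)
          ≈⟨ sum-cong-≋ (λ i → *-congˡ {x i} (Cker⇒clique-equation BRy≋x i)) ⟩
        x ∙ (R ⊛ y)
          ≈⟨ ∙-adjoint R x y ⟩
        (R ᵀ ⊛ x) ∙ y
          ≈⟨ sum-cong-≋ (λ j → trans (*-congʳ {y j} (Rᵀx≋𝟎 j)) (zeroˡ (y j))) ⟩
        ∑[ j < ∣S∣ ] 0#
          ≈⟨ sum-replicate-zero ∣S∣ ⟩
        0#  ∎)

      Cker-nonzero⇒Supp∩K : Nonzero (Cker 2≤∣K∣) → Satisfiable (Supp ∩ K)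
      Cker-nonzero⇒Supp∩K (x , (Rᵀx≋𝟎 , y , BRy≋x) , i , xᵢ#0) =
        -- The preimage `y` that witnesses membership in the image serves as the `S`-part of a null
        -- vector with `K`-part `x`.
        kᵥ i , (x ++ y , x++y∈𝒩 , #-congʳ (reflexive (≡.sym x++y-at-kᵥ)) xᵢ#0) , i , ≡.refl
        where
        x++y∈𝒩 : x ++ y ∈ 𝒩 adjacency
        x++y∈𝒩 p = trans (adjacency-⊛-++ x y p)
          (vertexRow≈0 (Cker⇒clique-equation BRy≋x) Rᵀx≋𝟎 (splitAt ∣K∣ p))

        x++y-at-kᵥ : (x ++ y) (position (kᵥ i)) ≡ x i
        x++y-at-kᵥ = ≡.trans (≡.cong (x ++ y) (position-kᵥ i)) (lookup-++ˡ x y i)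

theorem5p2 :
    ∀ {c ℓ₁ ℓ₂ ℓ₃} (ℝ : Reals c ℓ₁ ℓ₂ ℓ₃) (G : Graph) (Sp : SPartition G) →
    let open LinearAlgebra ℝ
        open SPartition Sp
        open SplitGraph ℝ Sp
    in
    (2≤∣K∣ : 2 ≤ ∣K∣) →
    Nonzero (Cker 2≤∣K∣) →
    Satisfiable (Supp ∩ K) ⇔ HasDimension (Cker 2≤∣K∣) 1
theorem5p2 ℝ G Sp 2≤∣K∣ Cker≠0 = mk⇔
  (λ _ → one-dimensional ℝ (Cker-lincomb ℝ Sp 2≤∣K∣) (Cker-norm ℝ Sp 2≤∣K∣) Cker≠0)
  (λ _ → Cker-nonzero⇒Supp∩K ℝ Sp 2≤∣K∣ Cker≠0)
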